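{- Let $H = (V,E)$ be a hypertree with $|V| = n$ such that $|e|$ is prime for each edge $e \in E$. Fix an ordering of the edges $E = \{e_1, \ldots, e_k\}$ with $|(e_{1} \cup \cdots \cup e_{i})\cap e_{i+1}| = 1$ for all $1 \leq i < k$, and fix a cyclic permutation $c_i: e_i\rightarrow e_i$ of each edge $e_i$. Then $$X_H = \sum_{\pi} F_{\mathrm{Des}_H(\pi)},$$ the sum over all bijections $\pi: V \to [n]$, where $\mathrm{Des}_H(\pi)$ is the set of $H$-descents of $\pi$ with respect to the chosen edge-ordering and cyclic permutations.
   Context: A hypergraph is a pair $H=(V,E)$ with $V$ finite and $E$ a family of subsets of $V$ with $|e|>1$. A path is a sequence $v_1, e_1, v_2, \ldots, e_m, v_{m+1}$ with $e_i \in E$, $v_i, v_{i+1} \in e_i$, edges distinct and vertices distinct except that $v_1 = v_{m+1}$ is allowed; if $v_1 = v_{m+1}$ and $m>1$ it is a cycle. A hypertree is a connected hypergraph with no cycles; between any two distinct vertices there is a unique path. $H$-descents: for a bijection $\pi: V \to [n]$ and $i \in [n-1]$, let $\pi^{ -1}(i) = v_1, e_{j_1}, v_2, \ldots, e_{j_l}, v_{l+1} = \pi^{ -1}(i+1)$ be the unique path, and let $j_r = \min(j_1,\ldots,j_l)$; then $i \in \mathrm{Des}_H(\pi)$ iff $\pi(c_{j_r}(v_r)) > \pi(c_{j_r}(v_{r+1}))$. A coloring $\chi: V \to \mathbb{P}=\{1,2,\ldots\}$ is proper if it is nonconstant on every edge; $X_H = \sum_\chi \prod_{v\in V} x_{\chi(v)}$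 over proper colorings. For $S \subseteq [n-1]$, $F_S = \sum x_{i_1}\cdots x_{i_n}$ over $i_1 \le \cdots \le i_n$ in $\mathbb{P}$ with $i_j < i_{j+1}$ whenever $j \in S$. -}

module Defs where

open import Data.Bool.Base using (T; true; false)
open import Data.Nat.Base as ℕ using (ℕ; zero; suc; pred)
open import Data.Nat.ListAction using (sum)
import Data.Nat.Properties as ℕ
open import Data.Fin.Base as Fin using (Fin; zero; suc; inject₁; fromℕ; toℕ)
import Data.Fin.Properties as Fin
open import Data.Fin.Permutation as Perm using (Permutation′; _⟨$⟩ʳ_; _⟨$⟩ˡ_; insert; remove)
open import Data.Fin.Subset using (Subset; _∈_; ∣_∣; _∩_; ⋃)
open import Data.Fin.Subset.Properties using (_∈?_; anySubset?)
open import Data.List.Base as List using (List; []; _∷_; length; filter; upTo; allFin; cartesianProductWith)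
import Data.List.Membership.Propositional as List
open import Data.List.Membership.Propositional.Properties
  using (∈-upTo⁺; ∈-filter⁺; ∈-filter⁻; ∈-cartesianProductWith⁺; ∈-allFin)
open import Data.List.Relation.Unary.Any using (Any; here)
import Data.List.Relation.Unary.Any.Properties as Any
import Data.List.Relation.Unary.All as AllL
import Data.List.Relation.Unary.AllPairs as AllPairs
open import Data.List.Relation.Unary.Unique.Propositional using (Unique)
import Data.List.Relation.Unary.Unique.Propositional.Properties as Unique
import Data.List.Relation.Unary.Unique.Setoid as UniqueS
import Data.List.Relation.Unary.Unique.Setoid.Properties as UniqueS
open import Data.Vec.Base as Vec using (Vec; []; _∷_; lookup; count)
open import Data.Vec.Properties using (∷-injective)
open import Data.Vec.Relation.Unary.All as All using (All; []; _∷_)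
open import Data.Product.Base using (∃; _×_; _,_; proj₁; proj₂)
open import Data.Sum.Base using (_⊎_)
open import Function.Bundles using (_↔_; _⇔_; Inverse; mk⇔)
open import Function.Definitions using (Injective)
import Function.Endo.Propositional as Endo
open import Level using (0ℓ)
open import Relation.Binary.Bundles using (Setoid)
open import Relation.Binary.PropositionalEquality
  using (_≡_; refl; sym; trans; cong; subst; setoid)
open import Relation.Nullary using (¬_; Dec; yes; no; does; contradiction)
open import Relation.Nullary.Decidable as Dec using (_×-dec_; _→-dec_; ¬?)
open import Relation.Unary using (Pred; Decidable)

private
  variable
    m n k : ℕ

-- ℙ = {1,2,…} is represented by ℕ, the number i standing for 1 + i.
ℙ : Set
ℙ = ℕ

record Monomial : Set where
  field
    exponent : ℙ → ℕ
    bound    : ℕ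
    vanishes : ∀ i → bound ℕ.≤ i → exponent i ≡ 0

open Monomial public

-- All the series involved have coefficients in ℕ.
PowerSeries : Set
PowerSeries = Monomial → ℕ

infix 4 _≈_
_≈_ : PowerSeries → PowerSeries → Set
f ≈ g = ∀ a → f a ≡ g a

-- x_{w₁} ⋯ x_{wₙ} = x^a
HasMonomial : Vec ℙ n → Monomial → Set
HasMonomial w a = ∀ i → count (ℕ._≟ i) w ≡ exponent a i

private
  ≡ᵇ-true : ∀ {i j} → (i ℕ.≡ᵇ j) ≡ true → i ≡ j
  ≡ᵇ-true {i} {j} eq = ℕ.≡ᵇ⇒≡ i j (subst T (sym eq) _)

  count-≥ : ∀ {b i} {w : Vec ℙ n} → All (ℕ._< b) w → b ℕ.≤ i → count (ℕ._≟ i) w ≡ 0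
  count-≥ [] b≤i = refl
  count-≥ {i = i} {w = x ∷ w} (x<b ∷ w<b) b≤i with x ℕ.≡ᵇ i in eq
  ... | true  = contradiction (subst (_ ℕ.≤_) (sym (≡ᵇ-true eq)) b≤i) (ℕ.<⇒≱ x<b)
  ... | false = count-≥ w<b b≤i

  count-0 : ∀ {b} (w : Vec ℙ n) → (∀ i → b ℕ.≤ i → count (ℕ._≟ i) w ≡ 0) → All (ℕ._< b) w
  count-0 [] h = []
  count-0 {b = b} (x ∷ w) h = ℕ.≰⇒> x≱b ∷ count-0 w tail
    where
    x≱b : ¬ (b ℕ.≤ x)
    x≱b b≤x with x ℕ.≡ᵇ x | ℕ.≡⇒≡ᵇ x x refl | h x b≤x
    ... | true  | _  | ()
    ... | false | () | _
    tail : ∀ i → b ℕ.≤ i → count (ℕ._≟ i) w ≡ 0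
    tail i b≤i with x ℕ.≡ᵇ i | h i b≤i
    ... | true  | ()
    ... | false | eq = eq

hasMonomial⇒bounded : (w : Vec ℙ n) (a : Monomial) → HasMonomial w a → All (ℕ._< bound a) w
hasMonomial⇒bounded w a h = count-0 w (λ i b≤i → trans (h i) (vanishes a i b≤i))

hasMonomial? : (w : Vec ℙ n) (a : Monomial) → Dec (HasMonomial w a)
hasMonomial? w a =
  Dec.map′ from to
    (All.all? (ℕ._<? bound a) w ×-dec
     ℕ.allUpTo? (λ i → count (ℕ._≟ i) w ℕ.≟ exponent a i) (bound a))
  where
  Bounded = All (ℕ._< bound a) w × (∀ {i} → i ℕ.< bound a → count (ℕ._≟ i) w ≡ exponent a i)
  from : Bounded → HasMonomial w a
  from (w<b , h) i with i ℕ.<? bound a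
  ... | yes i<b = h i<b
  ... | no  i≮b = trans (count-≥ w<b (ℕ.≮⇒≥ i≮b)) (sym (vanishes a i (ℕ.≮⇒≥ i≮b)))
  to : HasMonomial w a → Bounded
  to h = hasMonomial⇒bounded w a h , λ {i} _ → h i

words : ℕ → (n : ℕ) → List (Vec ℙ n)
words b zero    = [] ∷ []
words b (suc n) = cartesianProductWith _∷_ (upTo b) (words b n)

∈-words : ∀ {b} {w : Vec ℙ n} → All (ℕ._< b) w → w List.∈ words b n
∈-words []          = here refl
∈-words (x<b ∷ w<b) = ∈-cartesianProductWith⁺ _∷_ (∈-upTo⁺ x<b) (∈-words w<b)

words-unique : ∀ b n → Unique (words b n)
words-unique b zero    = AllL.[] AllPairs.∷ AllPairs.[]
words-unique b (suc n) =
  Unique.cartesianProductWith⁺ _∷_ ∷-injective (Unique.upTo⁺ b) (words-unique b n)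

-- The words w ∈ ℙⁿ satisfying P with x_{w₁} ⋯ x_{wₙ} = x^a.  The lemmas below
-- show that restricting to letters smaller than the bound loses nothing.
fiber : {P : Pred (Vec ℙ n) 0ℓ} → Decidable P → Monomial → List (Vec ℙ n)
fiber {n} P? a = filter (λ w → P? w ×-dec hasMonomial? w a) (words (bound a) n)

∈-fiber : {P : Pred (Vec ℙ n) 0ℓ} (P? : Decidable P) (a : Monomial) (w : Vec ℙ n) →
          w List.∈ fiber P? a ⇔ (P w × HasMonomial w a)
∈-fiber {n} P? a w = mk⇔
  (λ w∈ → proj₂ (∈-filter⁻ Q? {xs = words (bound a) n} w∈))
  (λ h → ∈-filter⁺ Q? (∈-words (hasMonomial⇒bounded w a (proj₂ h))) h)
  where Q? = λ w → P? w ×-dec hasMonomial? w a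

fiber-unique : {P : Pred (Vec ℙ n) 0ℓ} (P? : Decidable P) (a : Monomial) → Unique (fiber P? a)
fiber-unique {n} P? a =
  Unique.filter⁺ (λ w → P? w ×-dec hasMonomial? w a) (words-unique (bound a) n)

-- The formal sum of x_{w₁} ⋯ x_{wₙ} over all w ∈ ℙⁿ satisfying P.
∑-words : {P : Pred (Vec ℙ n) 0ℓ} → Decidable P → PowerSeries
∑-words P? a = length (fiber P? a)

permutations : (n : ℕ) → List (Permutation′ n)
permutations zero    = Perm.id ∷ []
permutations (suc n) = cartesianProductWith (insert zero) (allFin (suc n)) (permutations n)

private
  insert-cong : (i j : Fin (suc n)) {π ρ : Permutation′ n} →
                π Perm.≈ ρ → insert i j π Perm.≈ insert i j ρ
  insert-cong i j π≈ρ l with i Fin.≟ l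
  ... | yes _ = refl
  ... | no  _ = cong (Fin.punchIn j) (π≈ρ _)

  insert-zero-injective : {i j : Fin (suc n)} {π ρ : Permutation′ n} →
    insert zero i π Perm.≈ insert zero j ρ → i ≡ j × π Perm.≈ ρ
  insert-zero-injective {i = i} {π = π} {ρ} eq with eq zero
  ... | refl = refl , λ l → Fin.punchIn-injective i _ _
    (trans (sym (Perm.insert-punchIn zero i π l))
      (trans (eq (suc l)) (Perm.insert-punchIn zero i ρ l)))

permutationSetoid : ℕ → Setoid 0ℓ 0ℓ
permutationSetoid n = record
  { Carrier       = Permutation′ n
  ; _≈_           = Perm._≈_
  ; isEquivalence = record
    { refl  = λ _ → refl
    ; sym   = λ p i → sym (p i)
    ; trans = λ p q i → trans (p i) (q i)
    }
  }

permutations-complete : (π : Permutation′ n) → Any (π Perm.≈_) (permutations n)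
permutations-complete {zero}  π = here λ ()
permutations-complete {suc n} π =
  Any.cartesianProductWith⁺ (insert zero)
    (λ {j} {ρ} j≡ π≈ l → trans (sym (Perm.insert-remove zero π l))
      (subst (λ j → insert zero (π ⟨$⟩ʳ zero) (remove zero π) ⟨$⟩ʳ l ≡ insert zero j ρ ⟨$⟩ʳ l)
        j≡ (insert-cong zero (π ⟨$⟩ʳ zero) {remove zero π} {ρ} π≈ l)))
    (∈-allFin (π ⟨$⟩ʳ zero))
    (permutations-complete (remove zero π))

permutations-unique : ∀ n → UniqueS.Unique (permutationSetoid n) (permutations n)
permutations-unique zero    = AllL.[] AllPairs.∷ AllPairs.[]
permutations-unique (suc n) =
  UniqueS.cartesianProductWith⁺ (setoid (Fin (suc n))) (permutationSetoid n)
    (permutationSetoid (suc n)) (insert zero)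
    (λ {w} {x} {y} {z} → insert-zero-injective {i = w} {x} {y} {z})
    (Unique.allFin⁺ (suc n)) (permutations-unique n)

∑-bijections : (Permutation′ n → PowerSeries) → PowerSeries
∑-bijections {n} f a = sum (List.map (λ π → f π a) (permutations n))

-- i : Fin (pred n) stands for the element 1 + toℕ i of [n-1]; its images under
-- lower and upper stand for the elements 1 + toℕ i and 2 + toℕ i of [n].
lower upper : Fin (pred n) → Fin n
lower {suc n} i = inject₁ i
upper {suc n} i = suc i

Compatible : (n : ℕ) → Subset (pred n) → Pred (Vec ℙ n) 0ℓ
Compatible n S w =
  (∀ j → lookup w (lower j) ℕ.≤ lookup w (upper j)) ×
  (∀ j → j ∈ S → lookup w (lower j) ℕ.< lookup w (upper j))

compatible? : (n : ℕ) (S : Subset (pred n)) → Decidable (Compatible n S)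
compatible? n S w =
  Fin.all? (λ j → lookup w (lower j) ℕ.≤? lookup w (upper j)) ×-dec
  Fin.all? (λ j → (j ∈? S) →-dec (lookup w (lower j) ℕ.<? lookup w (upper j)))

F : (n : ℕ) → Subset (pred n) → PowerSeries
F n S = ∑-words (compatible? n S)

record Hypergraph (n : ℕ) : Set₁ where
  field
    E    : Pred (Subset n) 0ℓ
    E?   : Decidable E
    size : ∀ {e} → E e → 1 ℕ.< ∣ e ∣

open Hypergraph public

-- A path v₁, e₁, v₂, …, e_m, v_{m+1}.
record Path (H : Hypergraph n) (m : ℕ) : Set where
  field
    vertex         : Fin (suc m) → Fin n
    edge           : Fin m → Subset n
    edge∈E         : ∀ r → E H (edge r)
    source∈        : ∀ r → vertex (inject₁ r) ∈ edge r
    target∈        : ∀ r → vertex (suc r) ∈ edge r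
    edge-injective : Injective _≡_ _≡_ edge
    vertex-almost-injective : ∀ r s → vertex r ≡ vertex s →
      r ≡ s ⊎ (r ≡ zero × s ≡ fromℕ m) ⊎ (r ≡ fromℕ m × s ≡ zero)

  start end : Fin n
  start = vertex zero
  end   = vertex (fromℕ m)

record PathBetween (H : Hypergraph n) (u v : Fin n) : Set where
  field
    len  : ℕ
    path : Path H len
  open Path path public
  field
    start≡ : start ≡ u
    end≡   : end ≡ v

IsCycle : {H : Hypergraph n} → Path H m → Set
IsCycle {m = m} p = Path.start p ≡ Path.end p × 1 ℕ.< m

record IsHypertree (H : Hypergraph n) : Set where
  field
    connected : ∀ u v → PathBetween H u v
    acyclic   : (p : Path H m) → ¬ IsCycle p

record EdgeOrdering (H : Hypergraph n) (k : ℕ) : Set where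
  field
    edge       : Fin k → Subset n
    edge∈E     : ∀ j → E H (edge j)
    injective  : Injective _≡_ _≡_ edge
    surjective : ∀ {e} → E H e → ∃ λ j → edge j ≡ e

  -- |(e₁ ∪ ⋯ ∪ eᵢ) ∩ eᵢ₊₁| = 1 for 1 ≤ i < k; j : Fin k is the 0-based index of
  -- eᵢ₊₁, so that toℕ j = i.
  SingleIntersections : Set
  SingleIntersections =
    ∀ (j : Fin k) → 1 ℕ.≤ toℕ j →
    ∣ ⋃ (List.take (toℕ j) (List.tabulate edge)) ∩ edge j ∣ ≡ 1

Elem : Subset n → Set
Elem e = ∃ λ v → v ∈ e

-- A permutation of e consisting of a single cycle through all of e.
record CyclicPermutation (e : Subset n) : Set where
  field
    perm : Elem e ↔ Elem e
  open Inverse perm public using (to)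
  open Endo (Elem e) using (_^_)
  field
    transitive : ∀ x y → ∃ λ t → (to ^ t) x ≡ y

ConstantOn : Vec ℙ n → Subset n → Set
ConstantOn χ e = ∀ u v → u ∈ e → v ∈ e → lookup χ u ≡ lookup χ v

Proper : Hypergraph n → Pred (Vec ℙ n) 0ℓ
Proper H χ = ∀ e → E H e → ¬ ConstantOn χ e

constantOn? : (χ : Vec ℙ n) → Decidable (ConstantOn χ)
constantOn? χ e = Fin.all? λ u → Fin.all? λ v →
  (u ∈? e) →-dec ((v ∈? e) →-dec (lookup χ u ℕ.≟ lookup χ v))

proper? : (H : Hypergraph n) → Decidable (Proper H)
proper? H χ = Dec.map′
  (λ none e e∈E const → none (e , e∈E , const))
  (λ proper (e , e∈E , const) → proper e e∈E const)
  (¬? (anySubset? (λ e → E? H e ×-dec constantOn? χ e)))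

X : Hypergraph n → PowerSeries
X H = ∑-words (proper? H)

module _ {H : Hypergraph n} (T : IsHypertree H) (O : EdgeOrdering H k)
         (c : ∀ j → CyclicPermutation (EdgeOrdering.edge O j)) where

  private module O = EdgeOrdering O

  apply : ∀ j {e} → O.edge j ≡ e → ∀ {v} → v ∈ e → Fin n
  apply j refl {v} v∈e = proj₁ (CyclicPermutation.to (c j) (v , v∈e))

  module _ {u v : Fin n} (p : PathBetween H u v) where
    open PathBetween p

    edgeIndex : Fin len → Fin k
    edgeIndex r = proj₁ (O.surjective (edge∈E r))

    -- c_{j_r}(v_r) and c_{j_r}(v_{r+1})
    cSource cTarget : Fin len → Fin n
    cSource r = apply (edgeIndex r) (proj₂ (O.surjective (edge∈E r))) (source∈ r)
    cTarget r = apply (edgeIndex r) (proj₂ (O.surjective (edge∈E r))) (target∈ r)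

    DescendsAlong : Permutation′ n → Set
    DescendsAlong π = ∃ λ r →
      (∀ s → edgeIndex r Fin.≤ edgeIndex s) × (π ⟨$⟩ʳ cSource r) Fin.> (π ⟨$⟩ʳ cTarget r)

    descendsAlong? : ∀ π → Dec (DescendsAlong π)
    descendsAlong? π = Fin.any? λ r →
      Fin.all? (λ s → edgeIndex r Fin.≤? edgeIndex s) ×-dec
      ((π ⟨$⟩ʳ cTarget r) Fin.<? (π ⟨$⟩ʳ cSource r))

  -- Paths between distinct vertices of a hypertree are unique, so the one
  -- supplied by connectedness is the path of the definition.
  descentPath : (π : Permutation′ n) (i : Fin (pred n)) →
                PathBetween H (π ⟨$⟩ˡ lower i) (π ⟨$⟩ˡ upper i)
  descentPath π i = IsHypertree.connected T (π ⟨$⟩ˡ lower i) (π ⟨$⟩ˡ upper i)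

  Des : Permutation′ n → Subset (pred n)
  Des π = Vec.tabulate λ i → does (descendsAlong? (descentPath π i) π)

{-# OPTIONS --safe #-}
-- A pair (π, w) with w compatible with Des_H(π) is encoded by π and the colouring χ = w ∘ π, so it
-- suffices that exactly one π belongs to a proper χ and none to an improper one.  Fix π and, for
-- u ≠ v, let e_j be the edge of least index on the path from u to v, traversed from x to y.
-- Comparing colours first and π(c_j x) with π(c_j y) next is a transitive relation, so "no descents
-- inside colour classes" means that π is increasing for it, not just at consecutive positions.
-- If χ is constant on e_j, then c_j is monotone on e_j for π, which is absurd for a cycle of length
-- at least two.  If χ is proper, unrolling the condition shows that π must order u and v by the
-- sequences χ(c_j x), χ(c_j² x), … and χ(c_j y), χ(c_j² y), …; these differ because a nonconstant
-- cyclic word of prime length has no nontrivial period.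
module Submission where

import Data.Nat.Properties as ℕ
open import Algebra.Properties.CommutativeSemigroup ℕ.+-commutativeSemigroup using (x∙yz≈y∙xz)
import Algebra.Properties.CommutativeMonoid.Sum ℕ.+-0-commutativeMonoid as Sum+
open import Data.Bool.Base using (true; false; if_then_else_)
open import Data.Fin.Base as Fin using (Fin; zero; suc; inject₁; fromℕ; fromℕ<; toℕ)
import Data.Fin.Properties as Fin
open import Data.Fin.Permutation as Perm using (Permutation′; permutation; _⟨$⟩ʳ_; _⟨$⟩ˡ_)
open import Data.Fin.Subset using (Subset; _∈_; ∣_∣; ⋃; inside; outside)
open import Data.Fin.Subset.Properties using (_∈?_; x∈p∩q⁺; x∈p∪q⁺; p⊂q⇒∣p∣<∣q∣; ∈⊤; ∣⊤∣≡n)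
open import Data.List.Base as List using (List; []; _∷_; length; filter; applyUpTo)
import Data.List.Membership.Propositional as List
open import Data.List.Membership.Propositional.Properties
  using (∈-applyUpTo⁺; ∈-applyUpTo⁻; ∈-map⁺; ∈-map⁻; ∈-filter⁺; ∈-filter⁻)
open import Data.List.Membership.Propositional.Properties.WithK using (unique∧set⇒bag)
open import Data.List.Properties
  using (length-applyUpTo; length-map; map-cong; filter-none; filter-accept; filter-reject)
open import Data.List.Relation.Binary.BagAndSetEquality using (∼bag⇒↭)
open import Data.List.Relation.Binary.Permutation.Propositional.Properties using (↭-length)
open import Data.List.Relation.Unary.All as AllL using ([]; _∷_)
open import Data.List.Relation.Unary.AllPairs using (AllPairs; []; _∷_)
open import Data.List.Relation.Unary.Any as AnyL using (Any; here; there)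
open import Data.List.Relation.Unary.Unique.Propositional using (Unique)
import Data.List.Relation.Unary.Unique.Propositional.Properties as Unique
open import Data.Nat.Base as ℕ using (ℕ; zero; suc; pred; _+_; _*_; z≤n; s≤s; z<s; s<s)
open import Data.Nat.Coprimality using (Coprime; coprime-Bézout)
open import Data.Nat.Divisibility using (divides)
open import Data.Nat.DivMod using (_/_; _%_; m≡m%n+[m/n]*n; m%n<n)
open import Data.Nat.GCD using (module Bézout)
open import Data.Nat.ListAction using (sum)
open import Data.Nat.Primality using (Prime; prime⇒irreducible)
open import Data.Product.Base using (∃-syntax; _×_; _,_; proj₁; proj₂)
open import Data.Sum.Base as Sum using (_⊎_; inj₁; inj₂)
open import Data.Vec.Base as Vec using (Vec; []; _∷_; lookup; here; there; tabulate; count)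
import Data.Vec.Properties as Vec
open import Data.Vec.Properties.WithK using ([]=-irrelevant)
open import Function.Base using (_∘_; id)
open import Function.Bundles using (Equivalence; Inverse; mk⇔)
open import Function.Definitions using (Injective)
import Function.Endo.Propositional as Endo
open import Level using (0ℓ)
open import Relation.Binary.Construct.Closure.ReflexiveTransitive as Star using (Star; ε; _◅_; _◅◅_)
open import Relation.Binary.Definitions using (tri<; tri≈; tri>)
open import Relation.Binary.PropositionalEquality
  using (_≡_; _≢_; refl; sym; trans; cong; cong₂; subst; subst₂; ≢-sym; module ≡-Reasoning)
open import Relation.Nullary using (¬_; Dec; yes; no; does; contradiction)
open import Relation.Nullary.Decidable using (_×-dec_; ¬?; dec-true; decidable-stable)
open import Relation.Unary using (Pred; Decidable)
open import Defs

private
  variable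
    n k : ℕ

-- Finite subsets as duplicate-free lists.

unique-⇔⇒length≡ : {A : Set} {xs ys : List A} → Unique xs → Unique ys →
                   (∀ {z} → z List.∈ xs → z List.∈ ys) → (∀ {z} → z List.∈ ys → z List.∈ xs) →
                   length xs ≡ length ys
unique-⇔⇒length≡ xs! ys! xs⊆ys ys⊆xs =
  ↭-length (∼bag⇒↭ (unique∧set⇒bag xs! ys! (mk⇔ xs⊆ys ys⊆xs)))

elements : Subset n → List (Fin n)
elements []            = []
elements (inside  ∷ e) = zero ∷ List.map suc (elements e)
elements (outside ∷ e) = List.map suc (elements e)

length-elements : (e : Subset n) → length (elements e) ≡ ∣ e ∣
length-elements []            = refl
length-elements (inside  ∷ e) = cong suc (trans (length-map suc (elements e)) (length-elements e))
length-elements (outside ∷ e) = trans (length-map suc (elements e)) (length-elements e)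

∈-elements⁺ : ∀ {e : Subset n} {v} → v ∈ e → v List.∈ elements e
∈-elements⁺ {e = inside  ∷ e} here        = here refl
∈-elements⁺ {e = inside  ∷ e} (there v∈e) = there (∈-map⁺ suc (∈-elements⁺ v∈e))
∈-elements⁺ {e = outside ∷ e} (there v∈e) = ∈-map⁺ suc (∈-elements⁺ v∈e)

∈-elements⁻ : ∀ {e : Subset n} {v} → v List.∈ elements e → v ∈ e
∈-elements⁻ {e = inside  ∷ e} (here refl) = here
∈-elements⁻ {e = inside  ∷ e} (there v∈) with _ , u∈ , refl ← ∈-map⁻ suc v∈ = there (∈-elements⁻ u∈)
∈-elements⁻ {e = outside ∷ e} v∈         with _ , u∈ , refl ← ∈-map⁻ suc v∈ = there (∈-elements⁻ u∈)

elements-unique : (e : Subset n) → Unique (elements e)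
elements-unique []            = []
elements-unique (inside  ∷ e) =
  AllL.tabulate (λ v∈ 0≡v → Fin.0≢1+n (trans 0≡v (proj₂ (proj₂ (∈-map⁻ suc v∈)))))
  ∷ Unique.map⁺ Fin.suc-injective (elements-unique e)
elements-unique (outside ∷ e) = Unique.map⁺ Fin.suc-injective (elements-unique e)

∣e∣≡1⇒singleton : (e : Subset n) → ∣ e ∣ ≡ 1 → ∃[ a ] (a ∈ e × ∀ {b} → b ∈ e → b ≡ a)
∣e∣≡1⇒singleton e ∣e∣≡1 with elements e in eq | trans (length-elements e) ∣e∣≡1
... | a ∷ [] | refl =
  a , ∈-elements⁻ (subst (a List.∈_) (sym eq) (here refl)) ,
  λ {b} b∈e → is-head (subst (b List.∈_) eq (∈-elements⁺ b∈e))
  where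
  is-head : ∀ {b} → b List.∈ a ∷ [] → b ≡ a
  is-head (here b≡a) = b≡a

1<∣e∣⇒two-elements : (e : Subset n) → 1 ℕ.< ∣ e ∣ → ∃[ a ] ∃[ b ] (a ∈ e × b ∈ e × a ≢ b)
1<∣e∣⇒two-elements e 1<∣e∣
  with elements e in eq | subst (1 ℕ.<_) (sym (length-elements e)) 1<∣e∣ | elements-unique e
... | a ∷ b ∷ _ | _ | (a≢b ∷ _) ∷ _ =
  a , b , ∈-elements⁻ (subst (a List.∈_) (sym eq) (here refl)) ,
  ∈-elements⁻ (subst (b List.∈_) (sym eq) (there (here refl))) , a≢b
... | _ ∷ [] | s≤s () | _

least : {P : Pred ℕ 0ℓ} → Decidable P → ∀ t → P t → ∃[ q ] (P q × ∀ {r} → r ℕ.< q → ¬ P r)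
least P? t Pt with P? 0
... | yes P0 = 0 , P0 , λ ()
least P? zero    P0 | no ¬P0 = contradiction P0 ¬P0
least {P} P? (suc t) Pt | no ¬P0 with q , Pq , below ← least (P? ∘ suc) t Pt =
  suc q , Pq , minimal
  where
  minimal : ∀ {r} → r ℕ.< suc q → ¬ P r
  minimal {zero}  _         = ¬P0
  minimal {suc r} (s<s r<q) = below r<q

-- Iterates and cyclic permutations.

module _ {A : Set} (f : A → A) where
  open Endo A using (_^_)

  Reaches : A → A → Set
  Reaches x y = ∃[ t ] (f ^ t) x ≡ y

  ^-+ : ∀ s t x → (f ^ (s + t)) x ≡ (f ^ s) ((f ^ t) x)
  ^-+ zero    t x = refl
  ^-+ (suc s) t x = cong f (^-+ s t x)

  ^-comm : ∀ s t x → (f ^ s) ((f ^ t) x) ≡ (f ^ t) ((f ^ s) x)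
  ^-comm s t x = begin
    (f ^ s) ((f ^ t) x) ≡⟨ ^-+ s t x ⟨
    (f ^ (s + t)) x     ≡⟨ cong (λ r → (f ^ r) x) (ℕ.+-comm s t) ⟩
    (f ^ (t + s)) x     ≡⟨ ^-+ t s x ⟩
    (f ^ t) ((f ^ s) x) ∎
    where open ≡-Reasoning

  ^-*-fixed : ∀ a {q x} → (f ^ q) x ≡ x → (f ^ (a * q)) x ≡ x
  ^-*-fixed zero            fix = refl
  ^-*-fixed (suc a) {q} {x} fix =
    trans (^-+ q (a * q) x) (trans (cong (f ^ q) (^-*-fixed a fix)) fix)

-- A total function on `Fin n` stands for the cycle, so that its iterates carry no membership
-- proofs.
module Cycle (e : Subset n) (f : Fin n → Fin n)
             (f-∈ : ∀ {x} → x ∈ e → f x ∈ e)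
             (reach : ∀ {x y} → x ∈ e → y ∈ e → Reaches f x y) where
  open Endo (Fin n) using (_^_)

  ^-∈ : ∀ t {x} → x ∈ e → (f ^ t) x ∈ e
  ^-∈ zero    x∈e = x∈e
  ^-∈ (suc t) x∈e = f-∈ (^-∈ t x∈e)

  -- The return to `x` is sought from `f x`, which makes the number of steps positive; hence the
  -- form `suc q`.
  period : ∀ {x} → x ∈ e → ∃[ q ] ((f ^ suc q) x ≡ x × ∀ {r} → r ℕ.< q → (f ^ suc r) x ≢ x)
  period {x} x∈e with t , eq ← reach (f-∈ x∈e) x∈e =
    least (λ r → (f ^ suc r) x Fin.≟ x) t (trans (^-comm f 1 t x) eq)

  -- The iterates of `x` with exponents 0 to `q` list `e` without repetition: if those with
  -- exponents i < j ≤ q coincided, applying `f` until the larger exponent is `suc q` would give an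
  -- earlier return to `x`.
  ∣e∣≡period : ∀ {x q} → x ∈ e → (f ^ suc q) x ≡ x →
               (∀ {r} → r ℕ.< q → (f ^ suc r) x ≢ x) → ∣ e ∣ ≡ suc q
  ∣e∣≡period {x} {q} x∈e fix minimal = begin
    ∣ e ∣                            ≡⟨ length-elements e ⟨
    length (elements e)              ≡⟨ unique-⇔⇒length≡ (elements-unique e)
                                          (Unique.applyUpTo⁺₁ orbit (suc q) distinct) to from ⟩
    length (applyUpTo orbit (suc q)) ≡⟨ length-applyUpTo orbit (suc q) ⟩
    suc q                            ∎
    where
    open ≡-Reasoning
    orbit : ℕ → Fin n
    orbit t = (f ^ t) x

    distinct : ∀ {i j} → i ℕ.< j → j ℕ.< suc q → orbit i ≢ orbit j
    distinct {i} {j} i<j (s≤s j≤q) eq with d , refl ← ℕ.m≤n⇒∃[o]m+o≡n j≤q =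
      minimal {d + i} (subst (d + i ℕ.<_) (ℕ.+-comm d j) (ℕ.+-monoʳ-< d i<j)) (begin
        (f ^ (suc d + i)) x         ≡⟨ ^-+ f (suc d) i x ⟩
        (f ^ suc d) (orbit i)       ≡⟨ cong (f ^ suc d) eq ⟩
        (f ^ suc d) (orbit j)       ≡⟨ ^-+ f (suc d) j x ⟨
        (f ^ (suc d + j)) x         ≡⟨ cong (λ r → (f ^ suc r) x) (ℕ.+-comm d j) ⟩
        (f ^ suc (j + d)) x         ≡⟨ fix ⟩
        x                           ∎)

    to : ∀ {v} → v List.∈ elements e → v List.∈ applyUpTo orbit (suc q)
    to v∈ with t , refl ← reach x∈e (∈-elements⁻ {e = e} v∈) =
      subst (List._∈ applyUpTo orbit (suc q)) (sym (begin
        orbit t                                            ≡⟨ cong orbit (m≡m%n+[m/n]*n t (suc q)) ⟩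
        orbit (t % suc q + t / suc q * suc q)              ≡⟨ ^-+ f (t % suc q) _ x ⟩
        (f ^ (t % suc q)) ((f ^ (t / suc q * suc q)) x)    ≡⟨ cong (f ^ (t % suc q))
                                                                (^-*-fixed f (t / suc q) fix) ⟩
        orbit (t % suc q)                                  ∎))
        (∈-applyUpTo⁺ orbit (m%n<n t (suc q)))

    from : ∀ {v} → v List.∈ applyUpTo orbit (suc q) → v List.∈ elements e
    from v∈ with t , _ , refl ← ∈-applyUpTo⁻ orbit v∈ = ∈-elements⁺ (^-∈ t x∈e)

  ^∣e∣-fixed : ∀ {x} → x ∈ e → (f ^ ∣ e ∣) x ≡ x
  ^∣e∣-fixed {x} x∈e with q , fix , minimal ← period x∈e =
    subst (λ r → (f ^ r) x ≡ x) (sym (∣e∣≡period x∈e fix minimal)) fix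

  -- A common divisor is 1 or `∣ e ∣`; in the second case `s` is a multiple of `∣ e ∣`, and `f ^ s`
  -- would fix `x`.
  prime⇒coprime-shift : Prime ∣ e ∣ → ∀ {x s} → x ∈ e → (f ^ s) x ≢ x → Coprime ∣ e ∣ s
  prime⇒coprime-shift ∣e∣-prime x∈e moved (d∣∣e∣ , d∣s) with prime⇒irreducible ∣e∣-prime d∣∣e∣
  ... | inj₁ d≡1  = d≡1
  ... | inj₂ refl with divides a refl ← d∣s =
    contradiction (^-*-fixed f a (^∣e∣-fixed x∈e)) moved

  module _ (χ : Fin n → ℕ) where

    f-invariant⇒constant : (∀ {u} → u ∈ e → χ (f u) ≡ χ u) → ∀ {u v} → u ∈ e → v ∈ e → χ u ≡ χ v
    f-invariant⇒constant inv u∈e v∈e with t , refl ← reach u∈e v∈e = sym (go t)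
      where
      go : ∀ t → χ ((f ^ t) _) ≡ χ _
      go zero    = refl
      go (suc t) = trans (inv (^-∈ t u∈e)) (go t)

    ^-invariant⇒*-invariant : ∀ {s} → (∀ {u} → u ∈ e → χ ((f ^ s) u) ≡ χ u) →
                              ∀ a {u} → u ∈ e → χ ((f ^ (a * s)) u) ≡ χ u
    ^-invariant⇒*-invariant     inv zero        u∈e = refl
    ^-invariant⇒*-invariant {s} inv (suc a) {u} u∈e =
      trans (cong χ (^-+ f s (a * s) u))
        (trans (inv (^-∈ (a * s) u∈e)) (^-invariant⇒*-invariant inv a u∈e))

    -- By Bézout a single step is, modulo `∣ e ∣`, plus or minus a multiple of `s`, and `∣ e ∣`
    -- steps are the identity on `e`.
    coprime-invariant⇒f-invariant : ∀ {s} → Coprime ∣ e ∣ s →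
                                    (∀ {u} → u ∈ e → χ ((f ^ s) u) ≡ χ u) →
                                    ∀ {u} → u ∈ e → χ (f u) ≡ χ u
    coprime-invariant⇒f-invariant {s} cop inv {u} u∈e with coprime-Bézout cop
    -- The sign is negative here: `b * s` further steps lead from `f u` back to `u`.
    ... | Bézout.+- a b 1+bs≡ap = begin
      χ (f u)                     ≡⟨ ^-invariant⇒*-invariant inv b (f-∈ u∈e) ⟨
      χ ((f ^ (b * s)) (f u))     ≡⟨ cong χ (^-comm f (b * s) 1 u) ⟩
      χ ((f ^ (1 + b * s)) u)     ≡⟨ cong (λ r → χ ((f ^ r) u)) 1+bs≡ap ⟩
      χ ((f ^ (a * ∣ e ∣)) u)     ≡⟨ cong χ (^-*-fixed f a (^∣e∣-fixed u∈e)) ⟩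
      χ u                         ∎
      where open ≡-Reasoning
    ... | Bézout.-+ a b 1+ap≡bs = begin
      χ (f u)                     ≡⟨ cong (χ ∘ f) (^-*-fixed f a (^∣e∣-fixed u∈e)) ⟨
      χ ((f ^ (1 + a * ∣ e ∣)) u) ≡⟨ cong (λ r → χ ((f ^ r) u)) 1+ap≡bs ⟩
      χ ((f ^ (b * s)) u)         ≡⟨ ^-invariant⇒*-invariant inv b u∈e ⟩
      χ u                         ∎
      where open ≡-Reasoning

    -- Write y = f^s x. The orbit of `x` is all of `e`, so if the two colour sequences agreed
    -- everywhere, `χ` would be invariant under `f ^ s` on `e`. Since `s` is coprime to `∣ e ∣`, it
    -- would be invariant under `f` and thus constant.
    prime⇒separated : Prime ∣ e ∣ → ¬ (∀ u v → u ∈ e → v ∈ e → χ u ≡ χ v) →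
                      ∀ {x y} → x ∈ e → y ∈ e → x ≢ y → ∃[ t ] χ ((f ^ t) x) ≢ χ ((f ^ t) y)
    prime⇒separated ∣e∣-prime nonconstant {x} x∈e y∈e x≢y with s , refl ← reach x∈e y∈e
      with Fin.any? (λ u → (u ∈? e) ×-dec ¬? (χ ((f ^ s) u) ℕ.≟ χ u))
    ... | yes (u , u∈e , differ) with t , refl ← reach x∈e u∈e =
      t , λ eq → differ (trans (cong χ (^-comm f s t x)) (sym eq))
    ... | no none = contradiction
      (λ u v u∈e v∈e → f-invariant⇒constant
        (coprime-invariant⇒f-invariant (prime⇒coprime-shift ∣e∣-prime {s = s} x∈e (≢-sym x≢y))
          (λ {u} u∈e → decidable-stable (_ ℕ.≟ _) λ differ → none (u , u∈e , differ)))
        u∈e v∈e)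
      nonconstant

  -- The lexicographic order of the colour sequences χ x, χ (f x), χ (f² x), ….
  data _⊏[_]_ (x : Fin n) (χ : Fin n → ℕ) (y : Fin n) : Set where
    now   : χ x ℕ.< χ y → x ⊏[ χ ] y
    later : χ x ≡ χ y → f x ⊏[ χ ] f y → x ⊏[ χ ] y

  module _ {χ : Fin n → ℕ} where

    ⊏-trans : ∀ {x y z} → x ⊏[ χ ] y → y ⊏[ χ ] z → x ⊏[ χ ] z
    ⊏-trans (now x<y)     (now y<z)     = now (ℕ.<-trans x<y y<z)
    ⊏-trans (now x<y)     (later y≡z _) = now (ℕ.<-≤-trans x<y (ℕ.≤-reflexive y≡z))
    ⊏-trans (later x≡y _) (now y<z)     = now (ℕ.≤-<-trans (ℕ.≤-reflexive x≡y) y<z)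
    ⊏-trans (later x≡y p) (later y≡z q) = later (trans x≡y y≡z) (⊏-trans p q)

    ⊏-irrefl : ∀ {x} → ¬ (x ⊏[ χ ] x)
    ⊏-irrefl (now x<x)   = ℕ.<-irrefl refl x<x
    ⊏-irrefl (later _ p) = ⊏-irrefl p

    -- The first index where the sequences differ decides, and `t` bounds the search for it.
    separated⇒comparable : ∀ t {x y} → χ ((f ^ t) x) ≢ χ ((f ^ t) y) → x ⊏[ χ ] y ⊎ y ⊏[ χ ] x
    separated⇒comparable t {x} {y} differ with ℕ.<-cmp (χ x) (χ y)
    ... | tri< x<y _ _ = inj₁ (now x<y)
    ... | tri> _ _ y<x = inj₂ (now y<x)
    separated⇒comparable zero differ | tri≈ _ x≡y _ = contradiction x≡y differ
    separated⇒comparable (suc t) {x} {y} differ | tri≈ _ x≡y _ =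
      Sum.map (later x≡y) (later (sym x≡y))
        (separated⇒comparable t
          (subst₂ (λ u v → χ u ≢ χ v) (^-comm f 1 t x) (^-comm f 1 t y) differ))

  -- Monotonicity extends the ascent to x < f x < f² x < ..., and this chain comes back to `x`.
  monotone⇒¬ascent : {_<_ : Fin n → Fin n → Set} →
    (∀ {x y z} → x < y → y < z → x < z) → (∀ {x} → ¬ (x < x)) →
    (∀ {x y} → x ∈ e → y ∈ e → x < y → f x < f y) →
    ∀ {x} → x ∈ e → ¬ (x < f x)
  monotone⇒¬ascent {_<_} <-trans <-irrefl mono {x} x∈e x<fx with t , eq ← reach (f-∈ x∈e) x∈e =
    <-irrefl (subst (x <_) (trans (^-comm f 1 t x) eq) (ascending t))
    where
    step : ∀ t → (f ^ t) x < (f ^ suc t) x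
    step zero    = x<fx
    step (suc t) = mono (^-∈ t x∈e) (^-∈ (suc t) x∈e) (step t)
    ascending : ∀ t → x < (f ^ suc t) x
    ascending zero    = x<fx
    ascending (suc t) = <-trans (ascending t) (step (suc t))

  -- Neither an ascent nor, by reversing the order, a descent is possible at `x`. So `f` fixes `x`,
  -- whose orbit is all of `e`.
  monotone⇒trivial : (g : Fin n → ℕ) → (∀ {x y} → g x ≡ g y → x ≡ y) →
    (∀ {x y} → x ∈ e → y ∈ e → g x ℕ.< g y → g (f x) ℕ.< g (f y)) →
    ∀ {x y} → x ∈ e → y ∈ e → x ≡ y
  monotone⇒trivial g g-inj mono {x} x∈e y∈e with ℕ.<-cmp (g x) (g (f x))
  ... | tri< x<fx _ _ = contradiction x<fx
    (monotone⇒¬ascent {λ u v → g u ℕ.< g v} ℕ.<-trans (ℕ.<-irrefl refl) mono x∈e)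
  ... | tri> _ _ fx<x = contradiction fx<x
    (monotone⇒¬ascent {λ u v → g v ℕ.< g u} (λ p q → ℕ.<-trans q p) (ℕ.<-irrefl refl)
      (λ u∈e v∈e → mono v∈e u∈e) x∈e)
  ... | tri≈ _ x≡fx _ with t , refl ← reach x∈e y∈e = sym (fixed t)
    where
    fixed : ∀ t → (f ^ t) x ≡ x
    fixed zero    = refl
    fixed (suc t) = trans (cong f (fixed t)) (sym (g-inj x≡fx))

-- Permutations and finite linear orders.

∈-tabulate⁺ : {P : Pred (Fin n) 0ℓ} (P? : Decidable P) {i : Fin n} → P i → i ∈ tabulate (does ∘ P?)
∈-tabulate⁺ P? {i} p = Vec.lookup⇒[]= i _ (trans (Vec.lookup∘tabulate _ i) (dec-true (P? i) p))

∈-tabulate⁻ : {P : Pred (Fin n) 0ℓ} (P? : Decidable P) {i : Fin n} → i ∈ tabulate (does ∘ P?) → P i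
∈-tabulate⁻ P? {i} i∈
  with P? i | trans (sym (Vec.lookup∘tabulate (does ∘ P?) i)) (Vec.[]=⇒lookup i∈)
... | yes p | _ = p

-- Pigeonhole: punching out a missed value would squeeze `Fin (suc n)` injectively into `Fin n`.
injective⇒surjective : (f : Fin n → Fin n) → Injective _≡_ _≡_ f → ∀ y → ∃[ x ] f x ≡ y
injective⇒surjective {suc n} f f-inj y with Fin.any? (λ x → f x Fin.≟ y)
... | yes hit = hit
... | no miss = contradiction
  (λ {u v} eq → f-inj (Fin.punchOut-injective (avoids u) (avoids v) eq))
  (Fin.<⇒notInjective {f = λ x → Fin.punchOut (avoids x)} (ℕ.n<1+n n))
  where
  avoids : ∀ x → y ≢ f x
  avoids x y≡fx = miss (x , sym y≡fx)

injective⇒permutation : (f : Fin n → Fin n) → Injective _≡_ _≡_ f → Permutation′ n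
injective⇒permutation f f-inj = permutation f (proj₁ ∘ surj) (proj₂ ∘ surj)
  (λ x → f-inj (proj₂ (surj (f x))))
  where surj = injective⇒surjective f f-inj

-- Each element is sent to the number of elements below it. If u ≺ v, the lower set of `u` is
-- properly contained in that of `v`, with `u` itself as an extra element.
rank-permutation : {_≺_ : Fin n → Fin n → Set} →
  (∀ {u v w} → u ≺ v → v ≺ w → u ≺ w) → (∀ {u} → ¬ (u ≺ u)) →
  (∀ {u v} → u ≢ v → u ≺ v ⊎ v ≺ u) →
  ∃[ π ] (∀ {u v} → u ≺ v → (π ⟨$⟩ʳ u) Fin.< (π ⟨$⟩ʳ v))
rank-permutation {n} {_≺_} ≺-trans ≺-irrefl compare =
  injective⇒permutation rank rank-injective , rank-mono
  where
  _≺?_ : ∀ u v → Dec (u ≺ v)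
  u ≺? v with u Fin.≟ v
  ... | yes refl = no ≺-irrefl
  ... | no  u≢v with compare u≢v
  ...   | inj₁ u≺v = yes u≺v
  ...   | inj₂ v≺u = no λ u≺v → ≺-irrefl (≺-trans u≺v v≺u)

  below : Fin n → Subset n
  below v = tabulate λ u → does (u ≺? v)

  ∣below∣<n : ∀ v → ∣ below v ∣ ℕ.< n
  ∣below∣<n v = subst (∣ below v ∣ ℕ.<_) (∣⊤∣≡n n)
    (p⊂q⇒∣p∣<∣q∣ ((λ _ → ∈⊤) , v , ∈⊤ , ≺-irrefl ∘ ∈-tabulate⁻ (_≺? v)))

  rank : Fin n → Fin n
  rank v = fromℕ< (∣below∣<n v)

  rank-mono : ∀ {u v} → u ≺ v → rank u Fin.< rank v
  rank-mono {u} {v} u≺v = subst₂ ℕ._<_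
    (sym (Fin.toℕ-fromℕ< (∣below∣<n u))) (sym (Fin.toℕ-fromℕ< (∣below∣<n v)))
    (p⊂q⇒∣p∣<∣q∣
      ( (λ w∈ → ∈-tabulate⁺ (_≺? v) (≺-trans (∈-tabulate⁻ (_≺? u) w∈) u≺v))
      , u , ∈-tabulate⁺ (_≺? v) u≺v , ≺-irrefl ∘ ∈-tabulate⁻ (_≺? u)))

  rank-injective : Injective _≡_ _≡_ rank
  rank-injective {u} {v} eq with u Fin.≟ v
  ... | yes u≡v = u≡v
  ... | no  u≢v with compare u≢v
  ...   | inj₁ u≺v = contradiction (rank-mono u≺v) (Fin.<-irrefl eq)
  ...   | inj₂ v≺u = contradiction (rank-mono v≺u) (Fin.<-irrefl (sym eq))

-- The offset `b` serves the induction: once the first value is dropped, all others are at least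
-- `suc b`.
mono⇒offset≤ : ∀ b (g : Fin n → ℕ) → (∀ {i j} → i Fin.< j → g i ℕ.< g j) → (∀ i → b ℕ.≤ g i) →
               ∀ i → b + toℕ i ℕ.≤ g i
mono⇒offset≤ b g mono b≤g zero    = subst (ℕ._≤ g zero) (sym (ℕ.+-identityʳ b)) (b≤g zero)
mono⇒offset≤ b g mono b≤g (suc i) = subst (ℕ._≤ g (suc i)) (sym (ℕ.+-suc b (toℕ i)))
  (mono⇒offset≤ (suc b) (g ∘ suc) (mono ∘ s<s) (λ j → ℕ.≤-<-trans (b≤g zero) (mono z<s)) i)

-- The composite of ρ with the inverse of π is strictly increasing, so its value at each p is at
-- least p; take p to be the label of `u` under π.
same-order⇒≤ : (π ρ : Permutation′ n) →
               (∀ {u v} → (π ⟨$⟩ʳ u) Fin.< (π ⟨$⟩ʳ v) → (ρ ⟨$⟩ʳ u) Fin.< (ρ ⟨$⟩ʳ v)) →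
               ∀ u → (π ⟨$⟩ʳ u) Fin.≤ (ρ ⟨$⟩ʳ u)
same-order⇒≤ π ρ mono u = subst (λ v → (π ⟨$⟩ʳ u) Fin.≤ (ρ ⟨$⟩ʳ v)) (Perm.inverseˡ π)
  (mono⇒offset≤ 0 (λ i → toℕ (ρ ⟨$⟩ʳ (π ⟨$⟩ˡ i)))
    (λ i<j → mono (subst₂ Fin._<_ (sym (Perm.inverseʳ π)) (sym (Perm.inverseʳ π)) i<j))
    (λ _ → z≤n) (π ⟨$⟩ʳ u))

⟨$⟩ʳ-injective : (π : Permutation′ n) → ∀ {u v} → π ⟨$⟩ʳ u ≡ π ⟨$⟩ʳ v → u ≡ v
⟨$⟩ʳ-injective π eq = trans (sym (Perm.inverseˡ π)) (trans (cong (π ⟨$⟩ˡ_) eq) (Perm.inverseˡ π))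

consecutive⇒all : {_≺_ : Fin n → Fin n → Set} → (∀ {p q r} → p ≺ q → q ≺ r → p ≺ r) →
                  (∀ i → lower i ≺ upper i) → ∀ {p q} → p Fin.< q → p ≺ q
consecutive⇒all {suc zero}          tr step {zero}  {zero}        ()
consecutive⇒all {suc (suc n)} {_≺_} tr step {zero}  {suc zero}    p<q = step zero
consecutive⇒all {suc (suc n)} {_≺_} tr step {zero}  {suc (suc q)} p<q =
  tr (step zero) (consecutive⇒all {_≺_ = λ p q → suc p ≺ suc q} tr (step ∘ suc) {zero} {suc q} z<s)
consecutive⇒all {suc (suc n)} {_≺_} tr step {suc p} {suc q} (s<s p<q) =
  consecutive⇒all {_≺_ = λ p q → suc p ≺ suc q} tr (step ∘ suc) p<q

lower<upper : (i : Fin (pred n)) → lower {n} i Fin.< upper {n} i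
lower<upper {suc n} i = s≤s (ℕ.≤-reflexive (Fin.toℕ-inject₁ i))

-- Rearranged words and double counting.

count≡∑ : {P : Pred ℕ 0ℓ} (P? : Decidable P) (w : Vec ℕ n) →
          count P? w ≡ Sum+.sum (λ i → if does (P? (lookup w i)) then 1 else 0)
count≡∑ P? []      = refl
count≡∑ P? (x ∷ w) with does (P? x)
... | true  = cong suc (count≡∑ P? w)
... | false = count≡∑ P? w

-- Applied to a colouring χ, this gives the word w with χ = w ∘ π: its letters are the colours in
-- the order of the labels.
permute : Permutation′ n → Vec ℕ n → Vec ℕ n
permute π w = tabulate λ i → lookup w (π ⟨$⟩ˡ i)

lookup-permute : (π : Permutation′ n) (w : Vec ℕ n) →
                 ∀ i → lookup (permute π w) i ≡ lookup w (π ⟨$⟩ˡ i)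
lookup-permute π w = Vec.lookup∘tabulate _

permute-inverse : (π : Permutation′ n) (w : Vec ℕ n) → permute π (permute (Perm.flip π) w) ≡ w
permute-inverse π w = trans
  (Vec.tabulate-cong λ i →
    trans (lookup-permute (Perm.flip π) w (π ⟨$⟩ˡ i)) (cong (lookup w) (Perm.inverseʳ π)))
  (Vec.tabulate∘lookup w)

-- Guarantees that a colouring and its word have the same monomial; it reduces to the invariance of
-- finite sums under permutation.
count-permute : {P : Pred ℕ 0ℓ} (P? : Decidable P) (π : Permutation′ n) (w : Vec ℕ n) →
                count P? (permute π w) ≡ count P? w
count-permute P? π w = begin
  count P? (permute π w)
    ≡⟨ count≡∑ P? (permute π w) ⟩
  Sum+.sum (indicator ∘ lookup (permute π w))
    ≡⟨ Sum+.sum-cong-≗ (λ i → cong indicator (lookup-permute π w i)) ⟩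
  Sum+.sum (λ i → indicator (lookup w (Perm.flip π ⟨$⟩ʳ i)))
    ≡⟨ Sum+.sum-permute (indicator ∘ lookup w) (Perm.flip π) ⟨
  Sum+.sum (indicator ∘ lookup w)
    ≡⟨ count≡∑ P? w ⟨
  count P? w ∎
  where
  open ≡-Reasoning
  indicator : ℕ → ℕ
  indicator x = if does (P? x) then 1 else 0

module _ {A B : Set} {R : A → B → Set} (R? : ∀ x y → Dec (R x y)) where

  private
    column : List A → B → ℕ
    column xs y = length (filter (λ x → R? x y) xs)

    peel-row : ∀ x xs ys → sum (List.map (column (x ∷ xs)) ys) ≡
                           length (filter (R? x) ys) + sum (List.map (column xs) ys)
    peel-row x xs []       = refl
    peel-row x xs (y ∷ ys) with does (R? x y)
    ... | true  = cong suc (trans (cong (column xs y +_) (peel-row x xs ys))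
                                  (x∙yz≈y∙xz (column xs y) (length (filter (R? x) ys)) _))
    ... | false = trans (cong (column xs y +_) (peel-row x xs ys))
                        (x∙yz≈y∙xz (column xs y) (length (filter (R? x) ys)) _)

  double-count : ∀ xs ys → sum (List.map (λ y → length (filter (λ x → R? x y) xs)) ys) ≡
                           sum (List.map (λ x → length (filter (R? x) ys)) xs)
  double-count []       ys = zeros ys
    where
    zeros : ∀ ys → sum (List.map (column []) ys) ≡ 0
    zeros []       = refl
    zeros (_ ∷ ys) = zeros ys
  double-count (x ∷ xs) ys =
    trans (peel-row x xs ys) (cong (length (filter (R? x) ys) +_) (double-count xs ys))

sum-ones : {A : Set} (g : A → ℕ) (xs : List A) → (∀ {x} → x List.∈ xs → g x ≡ 1) →
           sum (List.map g xs) ≡ length xs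
sum-ones g []       ones = refl
sum-ones g (x ∷ xs) ones = cong₂ _+_ (ones (here refl)) (sum-ones g xs (ones ∘ there))

-- The relation `_~_` leaves room for pointwise equality, the sense in which the enumerated
-- permutations are distinct.
filter-singleton : {A : Set} {_~_ : A → A → Set} {P : Pred A 0ℓ} (P? : Decidable P) →
  (∀ {x y} → P x → P y → x ~ y) → ∀ {xs} → AllPairs (λ x y → ¬ (x ~ y)) xs → Any P xs →
  length (filter P? xs) ≡ 1
filter-singleton P? same (x≁ ∷ _) (here px) =
  trans (cong length (filter-accept P? px))
    (cong (suc ∘ length) (filter-none P? (AllL.map (λ x≁y py → x≁y (same px py)) x≁)))
filter-singleton {P = P} P? same {x ∷ xs} (x≁ ∷ distinct) (there any) =
  trans (cong length (filter-reject P? ¬px)) (filter-singleton P? same distinct any)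
  where
  ¬px : ¬ P x
  ¬px px = AllL.lookupWith (λ x≁y py → x≁y (same px py)) x≁ any

-- Initial unions of edges, minima and walks.

∈-⋃-take : (g : Fin k → Subset n) (i : Fin k) {m : ℕ} {x : Fin n} → toℕ i ℕ.< m → x ∈ g i →
           x ∈ ⋃ (List.take m (List.tabulate g))
∈-⋃-take g zero    z<s       x∈ = x∈p∪q⁺ (inj₁ x∈)
∈-⋃-take g (suc i) (s<s i<m) x∈ = x∈p∪q⁺ (inj₂ (∈-⋃-take (g ∘ suc) i i<m x∈))

minimum : (g : Fin (suc n) → Fin k) → ∃[ r ] (∀ s → g r Fin.≤ g s)
minimum {zero}  g = zero , λ { zero → ℕ.≤-refl }
minimum {suc n} g with r , least-r ← minimum (g ∘ suc)
  with ℕ.≤-total (toℕ (g zero)) (toℕ (g (suc r)))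
... | inj₁ 0≤r = zero  , λ { zero → ℕ.≤-refl ; (suc s) → ℕ.≤-trans 0≤r (least-r s) }
... | inj₂ r≤0 = suc r , λ { zero → r≤0      ; (suc s) → least-r s }

module _ {A : Set} {R : A → A → Set} where

  walk : ∀ {m} (f : Fin (suc m) → A) → (∀ s → R (f (inject₁ s)) (f (suc s))) →
         Star R (f zero) (f (fromℕ m))
  walk {zero}  f step = ε
  walk {suc m} f step = step zero ◅ walk (f ∘ suc) (step ∘ suc)

  -- Together with `walk-after` this cuts a walk at step `r`, which may fail to satisfy `R`; it will
  -- be the step along the edge of least index.
  walk-before : ∀ {m} (f : Fin (suc m) → A) (r : Fin m) →
                (∀ s → s Fin.< r → R (f (inject₁ s)) (f (suc s))) →
                Star R (f zero) (f (inject₁ r))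
  walk-before f zero    step = ε
  walk-before f (suc r) step =
    step zero z<s ◅ walk-before (f ∘ suc) r (λ s s<r → step (suc s) (s<s s<r))

  walk-after : ∀ {m} (f : Fin (suc m) → A) (r : Fin m) →
               (∀ s → r Fin.< s → R (f (inject₁ s)) (f (suc s))) →
               Star R (f (suc r)) (f (fromℕ m))
  walk-after {suc m} f zero    step = walk (f ∘ suc) (λ s → step (suc s) z<s)
  walk-after {suc m} f (suc r) step = walk-after (f ∘ suc) r (λ s r<s → step (suc s) (s<s r<s))

-- The edge of least index between two vertices.

module Junctions {H : Hypergraph n} (O : EdgeOrdering H k)
                 (single : EdgeOrdering.SingleIntersections O) where
  open EdgeOrdering O

  -- Every earlier edge lies in the union whose intersection with `edge j` is a singleton.
  attachment : ∀ (j : Fin k) → 1 ℕ.≤ toℕ j →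
               ∃[ a ] (∀ {i x} → i Fin.< j → x ∈ edge i → x ∈ edge j → x ≡ a)
  attachment j 1≤j with a , _ , only-a ← ∣e∣≡1⇒singleton _ (single j 1≤j) =
    a , λ {i} i<j x∈i x∈j → only-a (x∈p∩q⁺ (∈-⋃-take edge i i<j x∈i , x∈j))

  -- Collapse each of the edges e_i (j < i < m) onto its attachment vertex, the last edge first;
  -- no earlier edge is disturbed, since it meets e_i in the attachment vertex at most.
  retraction : ∀ j m → ∃[ φ ] ((∀ {x} → x ∈ edge j → φ x ≡ x) ×
    (∀ {i u v} → j Fin.< i → toℕ i ℕ.< m → u ∈ edge i → v ∈ edge i → φ u ≡ φ v))
  retraction j zero    = id , (λ _ → refl) , λ _ ()
  retraction j (suc m) with m ℕ.<? k | toℕ j ℕ.<? m | retraction j m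
  -- In this case and the next, no edge after `j` has index `m`, so there is nothing new to
  -- collapse.
  ... | no m≮k  | _ | φ , fixes , collapses = φ , fixes ,
    λ {i} j<i i≤m → collapses j<i (ℕ.≤∧≢⇒< (ℕ.s≤s⁻¹ i≤m) λ { refl → m≮k (Fin.toℕ<n i) })
  ... | yes _   | no j≮m | φ , fixes , collapses = φ , fixes ,
    λ {i} j<i i≤m → collapses j<i (ℕ.≤∧≢⇒< (ℕ.s≤s⁻¹ i≤m) λ { refl → j≮m j<i })
  ... | yes m<k | yes j<m | φ , fixes , collapses
    with l ← fromℕ< m<k in l-def
    with toℕ-l ← trans (cong toℕ (sym l-def)) (Fin.toℕ-fromℕ< m<k)
    with a , only-a ← attachment l (subst (1 ℕ.≤_) (sym toℕ-l) (ℕ.≤-trans (s≤s z≤n) j<m)) =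
    φ ∘ ρ ,
    (λ x∈j → trans (cong φ (ρ-fixes (subst (toℕ j ℕ.<_) (sym toℕ-l) j<m) x∈j)) (fixes x∈j)) ,
    collapses′
    where
    ρ : Fin n → Fin n
    ρ v with v ∈? edge l
    ... | yes _ = a
    ... | no  _ = v

    ρ-fixes : ∀ {i v} → i Fin.< l → v ∈ edge i → ρ v ≡ v
    ρ-fixes {v = v} i<l v∈i with v ∈? edge l
    ... | yes v∈l = sym (only-a i<l v∈i v∈l)
    ... | no  _   = refl

    ρ-collapses : ∀ {v} → v ∈ edge l → ρ v ≡ a
    ρ-collapses {v} v∈l with v ∈? edge l
    ... | yes _   = refl
    ... | no  v∉l = contradiction v∈l v∉l

    collapses′ : ∀ {i u v} → j Fin.< i → toℕ i ℕ.< suc m → u ∈ edge i → v ∈ edge i →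
                 φ (ρ u) ≡ φ (ρ v)
    collapses′ {i} j<i i≤m u∈i v∈i with toℕ i ℕ.<? m
    ... | yes i<m = trans (cong φ (ρ-fixes i<l u∈i))
                      (trans (collapses j<i i<m u∈i v∈i) (cong φ (sym (ρ-fixes i<l v∈i))))
      where i<l = subst (toℕ i ℕ.<_) (sym toℕ-l) i<m
    ... | no  i≮m with refl ← Fin.toℕ-injective {i = i} {j = l}
                        (trans (ℕ.≤-antisym (ℕ.s≤s⁻¹ i≤m) (ℕ.≮⇒≥ i≮m)) (sym toℕ-l)) =
      cong φ (trans (ρ-collapses u∈i) (sym (ρ-collapses v∈i)))

  Linked : Fin k → Fin n → Fin n → Set
  Linked j u v = ∃[ i ] (j Fin.< i × u ∈ edge i × v ∈ edge i)

  -- Connectivity in the subhypergraph formed by the edges of index greater than `j`.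
  _~[_]_ : Fin n → Fin k → Fin n → Set
  u ~[ j ] v = Star (Linked j) u v

  ~-sym : ∀ {j u v} → u ~[ j ] v → v ~[ j ] u
  ~-sym = Star.reverse λ (i , j<i , u∈ , v∈) → i , j<i , v∈ , u∈

  ~-weaken : ∀ {j l u v} → j Fin.< l → u ~[ l ] v → u ~[ j ] v
  ~-weaken j<l = Star.map λ (i , l<i , u∈ , v∈) → i , ℕ.<-trans j<l l<i , u∈ , v∈

  -- Collapsing all edges after `j` identifies linked vertices, yet leaves `edge j` pointwise fixed.
  ~-on-edge⇒≡ : ∀ {j x y} → x ∈ edge j → y ∈ edge j → x ~[ j ] y → x ≡ y
  ~-on-edge⇒≡ {j} x∈ y∈ x~y with φ , fixes , collapses ← retraction j k =
    trans (sym (fixes x∈)) (trans (go x~y) (fixes y∈))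
    where
    go : ∀ {u v} → u ~[ j ] v → φ u ≡ φ v
    go ε                            = refl
    go ((i , j<i , u∈ , v∈) ◅ rest) = trans (collapses j<i (Fin.toℕ<n i) u∈ v∈) (go rest)

  -- e_j is the edge of least index on the path from u to v, which traverses it from x to y.
  record Junction (u v : Fin n) (j : Fin k) (x y : Fin n) : Set where
    constructor junction
    field
      before : u ~[ j ] x
      x∈     : x ∈ edge j
      y∈     : y ∈ edge j
      x≢y    : x ≢ y
      after  : y ~[ j ] v

  open Junction

  junction-edge : ∀ {j x y} → x ∈ edge j → y ∈ edge j → x ≢ y → Junction x y j x y
  junction-edge x∈ y∈ x≢y = junction ε x∈ y∈ x≢y ε

  junction-sym : ∀ {u v j x y} → Junction u v j x y → Junction v u j y x
  junction-sym (junction before x∈ y∈ x≢y after) =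
    junction (~-sym after) y∈ x∈ (≢-sym x≢y) (~-sym before)

  junction⇒~ : ∀ {u v i j x y} → i Fin.< j → Junction u v j x y → u ~[ i ] v
  junction⇒~ {j = j} i<j (junction before x∈ y∈ _ after) =
    ~-weaken i<j before ◅◅ (j , i<j , x∈ , y∈) ◅ ~-weaken i<j after

  junction-irrefl : ∀ {u j x y} → ¬ Junction u u j x y
  junction-irrefl (junction before x∈ y∈ x≢y after) =
    x≢y (~-on-edge⇒≡ x∈ y∈ (~-sym before ◅◅ ~-sym after))

  -- This takes the place of uniqueness of paths. If j < j′, the second junction links `u` to `v` by
  -- edges after `j`, which forces x = y. If j = j′, the two entry vertices are linked by edges
  -- after `j`, hence equal, and so are the two exit vertices.
  junction-unique : ∀ {u v j x y j′ x′ y′} → Junction u v j x y → Junction u v j′ x′ y′ →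
                    j ≡ j′ × x ≡ x′ × y ≡ y′
  junction-unique {j = j} {j′ = j′} J J′ with Fin.<-cmp j j′
  ... | tri< j<j′ _ _ = contradiction
    (~-on-edge⇒≡ (x∈ J) (y∈ J) (~-sym (before J) ◅◅ junction⇒~ j<j′ J′ ◅◅ ~-sym (after J))) (x≢y J)
  ... | tri> _ _ j′<j = contradiction
    (~-on-edge⇒≡ (x∈ J′) (y∈ J′) (~-sym (before J′) ◅◅ junction⇒~ j′<j J ◅◅ ~-sym (after J′)))
    (x≢y J′)
  ... | tri≈ _ refl _ = refl ,
    ~-on-edge⇒≡ (x∈ J) (x∈ J′) (~-sym (before J) ◅◅ before J′) ,
    ~-on-edge⇒≡ (y∈ J) (y∈ J′) (after J ◅◅ ~-sym (after J′))

  module _ {u v : Fin n} (p : PathBetween H u v) (u≢v : u ≢ v) where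
    open PathBetween p using (len; vertex; source∈; target∈; start≡; end≡; vertex-almost-injective)
      renaming (edge to pathEdge; edge∈E to pathEdge∈E; edge-injective to pathEdge-injective)

    private
      index : Fin len → Fin k
      index s = proj₁ (surjective (pathEdge∈E s))

      index-edge : ∀ s → edge (index s) ≡ pathEdge s
      index-edge s = proj₂ (surjective (pathEdge∈E s))

      index-injective : ∀ {r s} → index r ≡ index s → r ≡ s
      index-injective {r} {s} eq = pathEdge-injective
        (trans (sym (index-edge r)) (trans (cong edge eq) (index-edge s)))

      source∈′ : ∀ s → vertex (inject₁ s) ∈ edge (index s)
      source∈′ s = subst (vertex (inject₁ s) ∈_) (sym (index-edge s)) (source∈ s)

      target∈′ : ∀ s → vertex (suc s) ∈ edge (index s)
      target∈′ s = subst (vertex (suc s) ∈_) (sym (index-edge s)) (target∈ s)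

      -- The one repetition a path allows is between its two ends, and these are `u` and `v`.
      step-moves : ∀ r → vertex (inject₁ r) ≢ vertex (suc r)
      step-moves r eq with vertex-almost-injective (inject₁ r) (suc r) eq
      ... | inj₁ same = ℕ.1+n≢n (trans (cong toℕ (sym same)) (Fin.toℕ-inject₁ r))
      ... | inj₂ (inj₁ (first , last)) = u≢v (begin
        u                    ≡⟨ start≡ ⟨
        vertex zero          ≡⟨ cong vertex first ⟨
        vertex (inject₁ r)   ≡⟨ eq ⟩
        vertex (suc r)       ≡⟨ cong vertex last ⟩
        vertex (fromℕ len)   ≡⟨ end≡ ⟩
        v                    ∎)
        where open ≡-Reasoning
      ... | inj₂ (inj₂ (_ , ()))

    -- The edges of a path are distinct, so every other step uses an edge of strictly larger index.
    path-junction : ∀ r → (∀ s → index r Fin.≤ index s) →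
                    Junction u v (index r) (vertex (inject₁ r)) (vertex (suc r))
    path-junction r least-r = junction
      (subst (_~[ index r ] vertex (inject₁ r)) start≡
        (walk-before vertex r λ s s<r → link s (Fin.<⇒≢ s<r)))
      (source∈′ r) (target∈′ r) (step-moves r)
      (subst (vertex (suc r) ~[ index r ]_) end≡
        (walk-after vertex r λ s r<s → link s (≢-sym (Fin.<⇒≢ r<s))))
      where
      link : ∀ s → s ≢ r → Linked (index r) (vertex (inject₁ s)) (vertex (suc s))
      link s s≢r =
        index s ,
        ℕ.≤∧≢⇒< (least-r s) (λ eq → s≢r (sym (index-injective (Fin.toℕ-injective eq)))) ,
        source∈′ s , target∈′ s

    path-has-minimum : ∃[ r ] (∀ s → index r Fin.≤ index s)
    -- The length is generalised to allow case analysis; length zero would give u = v.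
    path-has-minimum = go len refl index
      where
      go : ∀ m → m ≡ len → (g : Fin m → Fin k) → ∃[ r ] (∀ s → g r Fin.≤ g s)
      go zero    refl g = contradiction (trans (sym start≡) end≡) u≢v
      go (suc m) _    g = minimum g

  -- The tie-break `_⊰[_]_` is a parameter because two orders are needed: one from the labels of a
  -- permutation, one from the colour sequences alone.
  module JunctionOrder (χ : Fin n → ℕ) (_⊰[_]_ : Fin n → Fin k → Fin n → Set)
    (⊰-trans : ∀ j x y z → x ⊰[ j ] y → y ⊰[ j ] z → x ⊰[ j ] z)
    (⊰-irrefl : ∀ j x → ¬ (x ⊰[ j ] x)) where

    _≺_ : Fin n → Fin n → Set
    u ≺ v = χ u ℕ.< χ v ⊎ (χ u ≡ χ v × ∃[ j ] ∃[ x ] ∃[ y ] (Junction u v j x y × x ⊰[ j ] y))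

    ≺-irrefl : ∀ {u} → ¬ (u ≺ u)
    ≺-irrefl (inj₁ u<u)                   = ℕ.<-irrefl refl u<u
    ≺-irrefl (inj₂ (_ , _ , _ , _ , J , _)) = junction-irrefl J

    -- For equal colours the smaller of the two junction edges is the junction edge from `u` to `w`.
    -- If both are the same edge, the exit vertex of the first junction is the entry vertex of the
    -- second, and `_⊰[_]_` composes; its irreflexivity keeps `x` and `z` apart.
    ≺-trans : ∀ {u v w} → u ≺ v → v ≺ w → u ≺ w
    ≺-trans (inj₁ u<v) (inj₁ v<w)       = inj₁ (ℕ.<-trans u<v v<w)
    ≺-trans (inj₁ u<v) (inj₂ (v≡w , _)) = inj₁ (ℕ.<-≤-trans u<v (ℕ.≤-reflexive v≡w))
    ≺-trans (inj₂ (u≡v , _)) (inj₁ v<w) = inj₁ (ℕ.≤-<-trans (ℕ.≤-reflexive u≡v) v<w)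
    ≺-trans (inj₂ (u≡v , j , x , y , J , x⊰y)) (inj₂ (v≡w , j′ , y′ , z , J′ , y′⊰z))
      with Fin.<-cmp j j′
    ... | tri< j<j′ _ _ = inj₂ (trans u≡v v≡w , j , x , y ,
      junction (before J) (x∈ J) (y∈ J) (x≢y J) (after J ◅◅ junction⇒~ j<j′ J′) , x⊰y)
    ... | tri> _ _ j′<j = inj₂ (trans u≡v v≡w , j′ , y′ , z ,
      junction (junction⇒~ j′<j J ◅◅ before J′) (x∈ J′) (y∈ J′) (x≢y J′) (after J′) , y′⊰z)
    ... | tri≈ _ refl _ with refl ← ~-on-edge⇒≡ (y∈ J) (x∈ J′) (after J ◅◅ before J′) =
      inj₂ (trans u≡v v≡w , j , x , z ,
        junction (before J) (x∈ J) (y∈ J′) (λ { refl → ⊰-irrefl j x x⊰z }) (after J′) , x⊰z)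
      where x⊰z = ⊰-trans j x y z x⊰y y′⊰z

-- Descents and the permutations that sort a colouring.

module Descents {H : Hypergraph n} (T : IsHypertree H) (prime : ∀ e → E H e → Prime ∣ e ∣)
                (O : EdgeOrdering H k) (single : EdgeOrdering.SingleIntersections O)
                (c : ∀ j → CyclicPermutation (EdgeOrdering.edge O j)) where
  open EdgeOrdering O
  open Junctions O single
  open Endo using (_^_)

  -- c_j, extended by the identity outside e_j.
  rotate : Fin k → Fin n → Fin n
  rotate j v with v ∈? edge j
  ... | yes v∈ = proj₁ (CyclicPermutation.to (c j) (v , v∈))
  ... | no  _  = v

  rotate-to : ∀ j {v} (v∈ : v ∈ edge j) → rotate j v ≡ proj₁ (CyclicPermutation.to (c j) (v , v∈))
  rotate-to j {v} v∈ with v ∈? edge j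
  ... | yes v∈′ = cong (λ q → proj₁ (CyclicPermutation.to (c j) (v , q))) ([]=-irrelevant v∈′ v∈)
  ... | no  v∉  = contradiction v∈ v∉

  apply≡rotate : ∀ j {e} (eq : edge j ≡ e) {v} (v∈e : v ∈ e) → apply T O c j eq v∈e ≡ rotate j v
  apply≡rotate j refl v∈e = sym (rotate-to j v∈e)

  rotate-∈ : ∀ {j v} → v ∈ edge j → rotate j v ∈ edge j
  rotate-∈ {j} {v} v∈ =
    subst (_∈ edge j) (sym (rotate-to j v∈)) (proj₂ (CyclicPermutation.to (c j) (v , v∈)))

  rotate-injective : ∀ {j u v} → u ∈ edge j → v ∈ edge j → rotate j u ≡ rotate j v → u ≡ v
  rotate-injective {j} {u} {v} u∈ v∈ eq = cong proj₁ (begin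
    (u , u∈)           ≡⟨ strictlyInverseʳ _ ⟨
    from (to (u , u∈)) ≡⟨ cong from
                            (Elem-≡ (trans (sym (rotate-to j u∈)) (trans eq (rotate-to j v∈)))) ⟩
    from (to (v , v∈)) ≡⟨ strictlyInverseʳ _ ⟩
    (v , v∈)           ∎)
    where
    open ≡-Reasoning
    open Inverse (CyclicPermutation.perm (c j))
    Elem-≡ : ∀ {x y : Elem (edge j)} → proj₁ x ≡ proj₁ y → x ≡ y
    Elem-≡ {x , p} {.x , q} refl = cong (x ,_) ([]=-irrelevant p q)

  rotate-reach : ∀ j {x y} → x ∈ edge j → y ∈ edge j → Reaches (rotate j) x y
  rotate-reach j {x} x∈ y∈ with t , eq ← CyclicPermutation.transitive (c j) (x , x∈) (_ , y∈) =
    t , trans (iterate t) (cong proj₁ eq)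
    where
    iterate : ∀ t → (_^_ (Fin n) (rotate j) t) x ≡
                    proj₁ ((_^_ (Elem (edge j)) (CyclicPermutation.to (c j)) t) (x , x∈))
    iterate zero    = refl
    iterate (suc t) = trans (cong (rotate j) (iterate t)) (rotate-to j _)

  module Rotation (j : Fin k) = Cycle (edge j) (rotate j) rotate-∈ (rotate-reach j)

  preimages-distinct : (π : Permutation′ n) (i : Fin (pred n)) → π ⟨$⟩ˡ lower i ≢ π ⟨$⟩ˡ upper i
  preimages-distinct π i eq = Fin.<-irrefl
    (trans (sym (Perm.inverseʳ π)) (trans (cong (π ⟨$⟩ʳ_) eq) (Perm.inverseʳ π))) (lower<upper i)

  module _ (π : Permutation′ n) {i : Fin (pred n)} where
    private
      P   = descentPath T O c π i
      P?  = λ i → descendsAlong? T O c (descentPath T O c π i) π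
      u≢v = preimages-distinct π i

      index = edgeIndex T O c P

      index-edge : ∀ r → edge (index r) ≡ PathBetween.edge P r
      index-edge r = proj₂ (surjective (PathBetween.edge∈E P r))

      cSource≡ : ∀ r → cSource T O c P r ≡ rotate (index r) (PathBetween.vertex P (inject₁ r))
      cSource≡ r = apply≡rotate (index r) (index-edge r) (PathBetween.source∈ P r)

      cTarget≡ : ∀ r → cTarget T O c P r ≡ rotate (index r) (PathBetween.vertex P (suc r))
      cTarget≡ r = apply≡rotate (index r) (index-edge r) (PathBetween.target∈ P r)

    -- With its counterpart for non-descents, this replaces the chosen path by a junction; later
    -- arguments about descents no longer see paths.
    ∈Des⇒junction : i ∈ Des T O c π →
      ∃[ j ] ∃[ x ] ∃[ y ] (Junction (π ⟨$⟩ˡ lower i) (π ⟨$⟩ˡ upper i) j x y ×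
                            (π ⟨$⟩ʳ rotate j y) Fin.< (π ⟨$⟩ʳ rotate j x))
    ∈Des⇒junction i∈Des with r , least-r , descent ← ∈-tabulate⁻ P? i∈Des =
      _ , _ , _ , path-junction P u≢v r least-r ,
      subst₂ (λ a b → (π ⟨$⟩ʳ a) Fin.< (π ⟨$⟩ʳ b)) (cTarget≡ r) (cSource≡ r) descent

    ∉Des⇒junction : ¬ (i ∈ Des T O c π) →
      ∃[ j ] ∃[ x ] ∃[ y ] (Junction (π ⟨$⟩ˡ lower i) (π ⟨$⟩ˡ upper i) j x y ×
                            ¬ ((π ⟨$⟩ʳ rotate j y) Fin.< (π ⟨$⟩ʳ rotate j x)))
    ∉Des⇒junction i∉Des with r , least-r ← path-has-minimum P u≢v =
      _ , _ , _ , path-junction P u≢v r least-r ,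
      λ descent → i∉Des (∈-tabulate⁺ P? (r , least-r ,
        subst₂ (λ a b → (π ⟨$⟩ʳ a) Fin.< (π ⟨$⟩ʳ b)) (sym (cTarget≡ r)) (sym (cSource≡ r)) descent))

  exists-junction : ∀ {u v} → u ≢ v → ∃[ j ] ∃[ x ] ∃[ y ] Junction u v j x y
  exists-junction {u} {v} u≢v with p ← IsHypertree.connected T u v
    with r , least-r ← path-has-minimum p u≢v = _ , _ , _ , path-junction p u≢v r least-r

  module _ (χ : Vec ℙ n) where

    -- Like the definition of descents, `Along` and `Lex` compare the endpoints of the junction
    -- after one rotation.
    module Along (π : Permutation′ n) = JunctionOrder (lookup χ)
      (λ x j y → (π ⟨$⟩ʳ rotate j x) Fin.< (π ⟨$⟩ʳ rotate j y))
      (λ j x y z → ℕ.<-trans) (λ j x → ℕ.<-irrefl refl)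

    module Lex = JunctionOrder (lookup χ)
      (λ x j y → Rotation._⊏[_]_ j (rotate j x) (lookup χ) (rotate j y))
      (λ j x y z → Rotation.⊏-trans j) (λ j x → Rotation.⊏-irrefl j)

    -- π sorts the vertices by colour and has no H-descent between two vertices of one colour.
    Sorts : Permutation′ n → Set
    Sorts π = ∀ {u v} → (π ⟨$⟩ʳ u) Fin.< (π ⟨$⟩ʳ v) → Along._≺_ π u v

    Sorts-resp-≈ : ∀ π ρ → π Perm.≈ ρ → Sorts π → Sorts ρ
    Sorts-resp-≈ π ρ π≈ρ sorts ρu<ρv
      with sorts (subst₂ Fin._<_ (sym (π≈ρ _)) (sym (π≈ρ _)) ρu<ρv)
    ... | inj₁ u<v = inj₁ u<v
    ... | inj₂ (u≡v , j , x , y , J , x<y) =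
      inj₂ (u≡v , j , x , y , J , subst₂ Fin._<_ (π≈ρ _) (π≈ρ _) x<y)

    Arranged : Permutation′ n → Set
    Arranged π = Compatible n (Des T O c π) (permute π χ)

    -- Transitivity extends the comparison from consecutive labels to all. Consecutive vertices of
    -- equal colour cannot form a descent, and rotation keeps the junction endpoints distinct, so
    -- their labels strictly ascend.
    arranged⇒sorts : ∀ π → Arranged π → Sorts π
    arranged⇒sorts π (weak , strict) {u} {v} πu<πv =
      subst₂ _≺_ (Perm.inverseˡ π) (Perm.inverseˡ π)
        (consecutive⇒all {_≺_ = λ p q → (π ⟨$⟩ˡ p) ≺ (π ⟨$⟩ˡ q)} ≺-trans step πu<πv)
      where
      open Along π
      χ-at = lookup-permute π χ
      step : ∀ i → (π ⟨$⟩ˡ lower i) ≺ (π ⟨$⟩ˡ upper i)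
      step i with ℕ.m≤n⇒m<n∨m≡n (subst₂ ℕ._≤_ (χ-at (lower i)) (χ-at (upper i)) (weak i))
      ... | inj₁ u<v = inj₁ u<v
      ... | inj₂ u≡v with j , x , y , J , ascent ← ∉Des⇒junction π {i} (λ i∈Des → ℕ.<-irrefl u≡v
                            (subst₂ ℕ._<_ (χ-at (lower i)) (χ-at (upper i)) (strict i i∈Des))) =
        inj₂ (u≡v , j , x , y , J , ℕ.≤∧≢⇒< (ℕ.≮⇒≥ ascent) λ eq →
          Junction.x≢y J (rotate-injective (Junction.x∈ J) (Junction.y∈ J)
            (⟨$⟩ʳ-injective π (Fin.toℕ-injective eq))))

    private
      descends : ∀ {π : Permutation′ n} {u v j x y} → Junction u v j x y →
        ∃[ j ] ∃[ x ] ∃[ y ] (Junction u v j x y × (π ⟨$⟩ʳ rotate j y) Fin.< (π ⟨$⟩ʳ rotate j x)) →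
        ¬ ((π ⟨$⟩ʳ rotate j x) Fin.< (π ⟨$⟩ʳ rotate j y))
      descends J (_ , _ , _ , J′ , y<x)
        with refl , refl , refl ← junction-unique J J′ = ℕ.<-asym y<x

    sorts⇒arranged : ∀ π → Sorts π → Arranged π
    sorts⇒arranged π sorts =
      (λ i → subst₂ ℕ._≤_ (sym (χ-at (lower i))) (sym (χ-at (upper i))) (weak i)) ,
      (λ i i∈Des → subst₂ ℕ._<_ (sym (χ-at (lower i))) (sym (χ-at (upper i))) (strict i i∈Des))
      where
      open Along π
      χ-at = lookup-permute π χ
      step : ∀ i → (π ⟨$⟩ˡ lower i) ≺ (π ⟨$⟩ˡ upper i)
      step i =
        sorts (subst₂ Fin._<_ (sym (Perm.inverseʳ π)) (sym (Perm.inverseʳ π)) (lower<upper i))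
      weak : ∀ i → lookup χ (π ⟨$⟩ˡ lower i) ℕ.≤ lookup χ (π ⟨$⟩ˡ upper i)
      weak i with step i
      ... | inj₁ u<v       = ℕ.<⇒≤ u<v
      ... | inj₂ (u≡v , _) = ℕ.≤-reflexive u≡v
      strict : ∀ i → i ∈ Des T O c π → lookup χ (π ⟨$⟩ˡ lower i) ℕ.< lookup χ (π ⟨$⟩ˡ upper i)
      strict i i∈Des with step i
      ... | inj₁ u<v = u<v
      ... | inj₂ (_ , _ , _ , _ , J , x<y) =
        contradiction x<y (descends {π} J (∈Des⇒junction π i∈Des))

    -- Two vertices of an edge have that edge as their junction. If it were monochromatic, its
    -- rotation would preserve the order of labels, impossible for a cycle on at least two elements.
    sorts⇒proper : ∀ π → Sorts π → Proper H χ
    sorts⇒proper π sorts e e∈E constant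
      with j , refl ← surjective e∈E
      with a , b , a∈ , b∈ , a≢b ← 1<∣e∣⇒two-elements (edge j) (size H e∈E) =
      a≢b (Rotation.monotone⇒trivial j (λ v → toℕ (π ⟨$⟩ʳ v))
        (⟨$⟩ʳ-injective π ∘ Fin.toℕ-injective) mono a∈ b∈)
      where
      mono : ∀ {x y} → x ∈ edge j → y ∈ edge j → (π ⟨$⟩ʳ x) Fin.< (π ⟨$⟩ʳ y) →
             (π ⟨$⟩ʳ rotate j x) Fin.< (π ⟨$⟩ʳ rotate j y)
      mono {x} {y} x∈ y∈ πx<πy with sorts πx<πy
      ... | inj₁ x<y = contradiction x<y (ℕ.<-irrefl (constant x y x∈ y∈))
      ... | inj₂ (_ , _ , _ , _ , J , less)
        with refl , refl , refl ← junction-unique J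
               (junction-edge x∈ y∈ λ { refl → ℕ.<-irrefl refl πx<πy }) = less

    -- Induction on the derivation of `x⊏y`. With equal colours, the opposite order of labels would
    -- put `rotate j y` before `rotate j x`, against the induction hypothesis for the tails.
    ⊏⇒< : ∀ π → Sorts π → ∀ {j x y} → x ∈ edge j → y ∈ edge j →
          Rotation._⊏[_]_ j x (lookup χ) y → (π ⟨$⟩ʳ x) Fin.< (π ⟨$⟩ʳ y)
    ⊏⇒< π sorts {j} {x} {y} x∈ y∈ x⊏y with Fin.<-cmp (π ⟨$⟩ʳ x) (π ⟨$⟩ʳ y)
    ... | tri< πx<πy _ _ = πx<πy
    ... | tri≈ _ πx≡πy _ with refl ← ⟨$⟩ʳ-injective π πx≡πy =
      contradiction x⊏y (Rotation.⊏-irrefl j)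
    ... | tri> _ πx≢πy πy<πx with x⊏y | sorts πy<πx
    ...   | Rotation.now x<y     | inj₁ y<x       = contradiction y<x (ℕ.<-asym x<y)
    ...   | Rotation.now x<y     | inj₂ (y≡x , _) = contradiction x<y (ℕ.<-irrefl (sym y≡x))
    ...   | Rotation.later x≡y _ | inj₁ y<x       = contradiction y<x (ℕ.<-irrefl (sym x≡y))
    ...   | Rotation.later _ p   | inj₂ (_ , _ , _ , _ , J , less)
      with refl , refl , refl ← junction-unique J (junction-edge y∈ x∈ λ { refl → πx≢πy refl }) =
      contradiction less (ℕ.<-asym (⊏⇒< π sorts (rotate-∈ x∈) (rotate-∈ y∈) p))

    Lex⇒< : ∀ π → Sorts π → ∀ {u v} → u Lex.≺ v → (π ⟨$⟩ʳ u) Fin.< (π ⟨$⟩ʳ v)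
    Lex⇒< π sorts {u} {v} u≺v with Fin.<-cmp (π ⟨$⟩ʳ u) (π ⟨$⟩ʳ v)
    ... | tri< πu<πv _ _ = πu<πv
    ... | tri≈ _ πu≡πv _ with refl ← ⟨$⟩ʳ-injective π πu≡πv = contradiction u≺v Lex.≺-irrefl
    ... | tri> _ _ πv<πu with u≺v | sorts πv<πu
    ...   | inj₁ u<v       | inj₁ v<u       = contradiction v<u (ℕ.<-asym u<v)
    ...   | inj₁ u<v       | inj₂ (v≡u , _) = contradiction u<v (ℕ.<-irrefl (sym v≡u))
    ...   | inj₂ (u≡v , _) | inj₁ v<u       = contradiction v<u (ℕ.<-irrefl (sym u≡v))
    ...   | inj₂ (_ , _ , _ , _ , J , x⊏y) | inj₂ (_ , _ , _ , _ , J′ , less)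
      with refl , refl , refl ← junction-unique (junction-sym J) J′ =
      contradiction less (ℕ.<-asym
        (⊏⇒< π sorts (rotate-∈ (Junction.x∈ J)) (rotate-∈ (Junction.y∈ J)) x⊏y))

    module _ (proper : Proper H χ) where

      -- Properness and prime size enter here: on the junction edge, distinct vertices have distinct
      -- colour sequences.
      Lex-compare : ∀ {u v} → u ≢ v → u Lex.≺ v ⊎ v Lex.≺ u
      Lex-compare {u} {v} u≢v with ℕ.<-cmp (lookup χ u) (lookup χ v)
      ... | tri< u<v _ _ = inj₁ (inj₁ u<v)
      ... | tri> _ _ v<u = inj₂ (inj₁ v<u)
      ... | tri≈ _ u≡v _ with j , x , y , J ← exists-junction u≢v
        with t , differ ← Rotation.prime⇒separated j (lookup χ) (prime (edge j) (edge∈E j))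
               (proper (edge j) (edge∈E j)) (rotate-∈ (Junction.x∈ J)) (rotate-∈ (Junction.y∈ J))
               (Junction.x≢y J ∘ rotate-injective (Junction.x∈ J) (Junction.y∈ J))
        with Rotation.separated⇒comparable j {lookup χ} t differ
      ...   | inj₁ x⊏y = inj₁ (inj₂ (u≡v , j , x , y , J , x⊏y))
      ...   | inj₂ y⊏x = inj₂ (inj₂ (sym u≡v , j , y , x , junction-sym J , y⊏x))

      <⇒Lex : ∀ (π : Permutation′ n) → (∀ {u v} → u Lex.≺ v → (π ⟨$⟩ʳ u) Fin.< (π ⟨$⟩ʳ v)) →
              ∀ {u v} → (π ⟨$⟩ʳ u) Fin.< (π ⟨$⟩ʳ v) → u Lex.≺ v
      <⇒Lex π mono πu<πv with Lex-compare (λ { refl → ℕ.<-irrefl refl πu<πv })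
      ... | inj₁ u≺v = u≺v
      ... | inj₂ v≺u = contradiction (mono v≺u) (ℕ.<-asym πu<πv)

      sorts-exists : ∃[ π ] Sorts π
      sorts-exists = π , λ πu<πv → sorts (<⇒Lex π mono πu<πv)
        where
        ranking = rank-permutation Lex.≺-trans Lex.≺-irrefl Lex-compare
        π = proj₁ ranking
        mono : ∀ {u v} → u Lex.≺ v → (π ⟨$⟩ʳ u) Fin.< (π ⟨$⟩ʳ v)
        mono = proj₂ ranking
        sorts : ∀ {u v} → u Lex.≺ v → Along._≺_ π u v
        sorts (inj₁ u<v) = inj₁ u<v
        sorts (inj₂ (u≡v , j , x , y , J , Rotation.now x<y)) =
          inj₂ (u≡v , j , x , y , J , mono (inj₁ x<y))
        -- The rotated endpoints have `edge j` as their own junction, so the tail of the comparison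
        -- already orders them in `Lex`.
        sorts (inj₂ (u≡v , j , x , y , J , Rotation.later x≡y x⊏y)) =
          inj₂ (u≡v , j , x , y , J , mono (inj₂ (x≡y , j , _ , _ ,
            junction-edge (rotate-∈ (Junction.x∈ J)) (rotate-∈ (Junction.y∈ J))
              (Junction.x≢y J ∘ rotate-injective (Junction.x∈ J) (Junction.y∈ J)) , x⊏y)))

      -- Any sorting permutation induces exactly the order `Lex`, which does not depend on it.
      sorts-≤ : ∀ π ρ → Sorts π → Sorts ρ → ∀ u → (π ⟨$⟩ʳ u) Fin.≤ (ρ ⟨$⟩ʳ u)
      sorts-≤ π ρ sortsπ sortsρ =
        same-order⇒≤ π ρ (λ πu<πv → Lex⇒< ρ sortsρ (<⇒Lex π (Lex⇒< π sortsπ) πu<πv))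

      sorts-unique : ∀ π ρ → Sorts π → Sorts ρ → π Perm.≈ ρ
      sorts-unique π ρ sortsπ sortsρ u =
        Fin.≤-antisym (sorts-≤ π ρ sortsπ sortsρ u) (sorts-≤ ρ π sortsρ sortsπ u)

    -- Comparison of coefficients.

    arranged? : Decidable Arranged
    arranged? π = compatible? n (Des T O c π) (permute π χ)

    arrangements-singleton : Proper H χ → length (filter arranged? (permutations n)) ≡ 1
    arrangements-singleton proper = filter-singleton {_~_ = Perm._≈_} arranged?
      (λ {π} {ρ} aπ aρ → sorts-unique proper π ρ (arranged⇒sorts π aπ) (arranged⇒sorts ρ aρ))
      (permutations-unique n)
      (AnyL.map (λ {ρ} → arranged ρ) (permutations-complete (proj₁ (sorts-exists proper))))
      where
      arranged : ∀ ρ → proj₁ (sorts-exists proper) Perm.≈ ρ → Arranged ρ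
      arranged ρ π≈ρ = sorts⇒arranged ρ
        (Sorts-resp-≈ (proj₁ (sorts-exists proper)) ρ π≈ρ (proj₂ (sorts-exists proper)))

  -- `permute π` is a bijection from the arranged proper colourings to the compatible words; the
  -- colouring recovered from a compatible word is proper by `sorts⇒proper`.
  F-coefficient : ∀ π a → F n (Des T O c π) a ≡
                  length (filter (λ χ → arranged? χ π) (fiber (proper? H) a))
  F-coefficient π a = trans
    (unique-⇔⇒length≡ (fiber-unique Q? a)
      (Unique.map⁺ permute-injective
        (Unique.filter⁺ (λ χ → arranged? χ π) (fiber-unique (proper? H) a)))
      to from)
    (length-map (permute π) arrangedColourings)
    where
    permute-injective : ∀ {w w′} → permute π w ≡ permute π w′ → w ≡ w′
    permute-injective {w} {w′} eq = trans (sym (permute-inverse (Perm.flip π) w))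
      (trans (cong (permute (Perm.flip π)) eq) (permute-inverse (Perm.flip π) w′))

    Q? = compatible? n (Des T O c π)
    compatibleWords    = fiber Q? a
    arrangedColourings = filter (λ χ → arranged? χ π) (fiber (proper? H) a)
    arrangedWords      = List.map (permute π) arrangedColourings

    to : ∀ {w} → w List.∈ compatibleWords → w List.∈ arrangedWords
    to {w} w∈ with compatible , mono ← Equivalence.to (∈-fiber Q? a w) w∈ =
      subst (List._∈ arrangedWords) (permute-inverse π w)
        (∈-map⁺ (permute π) (∈-filter⁺ (λ χ → arranged? χ π)
          (Equivalence.from (∈-fiber (proper? H) a χ)
            ( sorts⇒proper χ π (arranged⇒sorts χ π arranged)
            , λ i → trans (count-permute (ℕ._≟ i) (Perm.flip π) w) (mono i)))
          arranged))
      where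
      χ = permute (Perm.flip π) w
      arranged : Arranged χ π
      arranged = subst (Compatible n (Des T O c π)) (sym (permute-inverse π w)) compatible

    permute-∈ : ∀ {χ} → χ List.∈ arrangedColourings → permute π χ List.∈ compatibleWords
    permute-∈ {χ} χ∈ = Equivalence.from (∈-fiber Q? a (permute π χ))
      (proj₂ filtered , λ i → trans (count-permute (ℕ._≟ i) π χ)
        (proj₂ (Equivalence.to (∈-fiber (proper? H) a χ) (proj₁ filtered)) i))
      where filtered = ∈-filter⁻ (λ χ → arranged? χ π) {xs = fiber (proper? H) a} χ∈

    from : ∀ {w} → w List.∈ arrangedWords → w List.∈ compatibleWords
    from w∈ = let _ , χ∈ , w≡ = ∈-map⁻ (permute π) w∈ in
      subst (List._∈ compatibleWords) (sym w≡) (permute-∈ χ∈)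

  -- The pairs of a proper colouring and a permutation arranging it are counted twice: by
  -- permutations they give the coefficients of the `F`, by colourings exactly one each.
  X≈∑F : X H ≈ ∑-bijections (λ π → F n (Des T O c π))
  X≈∑F a = sym (begin
    sum (List.map (λ π → F n (Des T O c π) a) (permutations n))
      ≡⟨ cong sum (map-cong (λ π → F-coefficient π a) (permutations n)) ⟩
    sum (List.map (λ π → length (filter (λ χ → arranged? χ π) colourings)) (permutations n))
      ≡⟨ double-count arranged? colourings (permutations n) ⟩
    sum (List.map (λ χ → length (filter (arranged? χ) (permutations n))) colourings)
      ≡⟨ sum-ones _ colourings (λ {χ} χ∈ → arrangements-singleton χ
           (proj₁ (Equivalence.to (∈-fiber (proper? H) a χ) χ∈))) ⟩
    length colourings ∎)
    where
    open ≡-Reasoning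
    colourings = fiber (proper? H) a

theorem4p3 : ∀ {n k : ℕ} (H : Hypergraph n) (T : IsHypertree H) →
    (∀ (e : Subset n) → E H e → Prime ∣ e ∣) →
    (O : EdgeOrdering H k) → EdgeOrdering.SingleIntersections O →
    (c : ∀ j → CyclicPermutation (EdgeOrdering.edge O j)) →
    X H ≈ ∑-bijections (λ π → F n (Des T O c π))
theorem4p3 H T prime O single c = Descents.X≈∑F T prime O single c
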